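{- Let $\lambda\in\{1,2\}$ and let $u,t,v,w$ be integers such that: $(u,t)$ satisfies $S_{\lambda,1}$ and $u\cdot(vw)=t^3+t^{\lambda}+1$ (so $u,t,vw$ are consecutive terms of $\langle u,t\rangle_{S_{\lambda,1}}=\langle t,vw\rangle_{S_{2,\lambda}}$); $(v,t)$ satisfies $S_{\lambda,1}$ (so $v,t,uw$ are consecutive terms of $\langle v,t\rangle_{S_{\lambda,1}}=\langle t,uw\rangle_{S_{2,\lambda}}$); $|t|$ is a prime; and $t\nmid (u-v)$. Then $(-w,t)$ satisfies $S_{\lambda,1}$, so $-w,t,-uv$ are, in that order, three consecutive terms of a third 4-chain $\langle -w,t\rangle_{S_{\lambda,1}}=\langle t,-uv\rangle_{S_{2,\lambda}}$.
   Context: For $\lambda_a,\lambda_b\in\{1,2\}$, a pair of integers $(x,y)$ satisfies the system $S_{\lambda_a,\lambda_b}$ if $x\mid y^3+y^{\lambda_a}+1$ and $y\mid x^3+x^{\lambda_b}+1$. For such a pair, $\langle x,y\rangle_{S_{\lambda_a,\lambda_b}}$ denotes the bi-infinite integer sequence $(u_n)$ with $u_0=x$, $u_1=y$ and $u_{n-1}u_{n+1}=u_n^3+u_n^{e_n}+1$ for all $n$, where $e_n$ has period 4 with $(e_0,e_1,e_2,e_3)=(\lambda_b,\lambda_a,3-\lambda_b,3-\lambda_a)$; sequences are identified up to shift and reversal of indices. "$u,t,s$, in that order, are three consecutive terms of $\langle u,t\rangle_{S_{\lambda_a,\lambda_b}}$" means $(u,t)$ satisfies $S_{\lambda_a,\lambda_b}$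 and $us=t^3+t^{\lambda_a}+1$. -}

module Defs where

open import Data.Integer.Base using (ℤ; _+_; _-_; _*_; _^_; 0ℤ; 1ℤ; _%ℕ_)
open import Data.Integer.Divisibility.Signed using (_∣_)
open import Data.Nat.Base using (ℕ; _∸_)
open import Data.Product.Base using (∃-syntax; _×_)
open import Data.Sum.Base using (_⊎_)
open import Relation.Binary.PropositionalEquality.Core using (_≡_)

-- The systems S_{a,b} below are meant for a, b ∈ {1, 2}; the exponents are
-- arbitrary naturals here, and statements restrict them.

poly : ℕ → ℤ → ℤ
poly e x = x ^ 3 + x ^ e + 1ℤ

Satisfies : (a b : ℕ) (x y : ℤ) → Set
Satisfies a b x y = (x ∣ poly a y) × (y ∣ poly b x)

-- The 4-periodic exponents (e₀, e₁, e₂, e₃) = (b, a, 3 ∸ b, 3 ∸ a), with e₀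
-- belonging to the term x and e₁ to the term y of ⟨ x , y ⟩.  The remainder
-- n %ℕ 4 lies in {0, 1, 2, 3} for negative n as well.
exponent : (a b : ℕ) → ℤ → ℕ
exponent a b n = go (n %ℕ 4)
  where
  go : ℕ → ℕ
  go 0 = b
  go 1 = a
  go 2 = 3 ∸ b
  go _ = 3 ∸ a

-- IsChain a b x y s : the bi-infinite sequence s is ⟨ x , y ⟩ for S_{a,b}.
record IsChain (a b : ℕ) (x y : ℤ) (s : ℤ → ℤ) : Set where
  field
    satisfies  : Satisfies a b x y
    start₀     : s 0ℤ ≡ x
    start₁     : s 1ℤ ≡ y
    recurrence : ∀ n → s (n - 1ℤ) * s (n + 1ℤ) ≡ poly (exponent a b n) (s n)

infix 4 _≈_

-- Equality of sequences up to shift and reversal of indices.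
_≈_ : (s s′ : ℤ → ℤ) → Set
s ≈ s′ = ∃[ k ] ((∀ n → s′ n ≡ s (n + k)) ⊎ (∀ n → s′ n ≡ s (k - n)))

-- ⟨ x , y ⟩ for S_{a,b} and ⟨ x′ , y′ ⟩ for S_{a′,b′} both exist and are equal.
-- A chain is specified by a predicate rather than computed, so the equality is
-- asserted for all sequences meeting the two specifications; taking both
-- specifications to be inhabited rules out vacuity.
SameChain : (a b : ℕ) (x y : ℤ) (a′ b′ : ℕ) (x′ y′ : ℤ) → Set
SameChain a b x y a′ b′ x′ y′ =
    (∃[ s ] IsChain a b x y s)
  × (∃[ s′ ] IsChain a′ b′ x′ y′ s′)
  × (∀ s s′ → IsChain a b x y s → IsChain a′ b′ x′ y′ s′ → s ≈ s′)

-- u , t , s, in that order, are three consecutive terms of ⟨ u , t ⟩ for S_{a,b}.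
Consecutive : (a b : ℕ) (u t s : ℤ) → Set
Consecutive a b u t s = Satisfies a b u t × u * s ≡ poly a t

{-# OPTIONS --safe #-}
-- Modulo t the integers u and v are distinct roots of the cubic X³ + X + 1, so
-- its third root is − (u + v), and Vieta gives u v (u + v) ≡ 1.  As u v w ≡ 1
-- too, − w is the third root.  A pair satisfying a system extends to a chain
-- because u₀ u₂ ≡ 1 mod u₁ and X³ + X^e + 1 has reciprocal polynomial
-- X³ + X^(3−e) + 1; the chain is unique because its terms cannot vanish.
module Submission where

open import Defs
open import Data.Integer.Base using (ℤ; +_; -[1+_]; _+_; _-_; _*_; _^_; -_; ∣_∣; 0ℤ; 1ℤ; ≢-nonZero)
open import Data.Integer.Divisibility.Signed using (_∣_; divides; quotient; ∣ᵤ⇒∣; ∣⇒∣ᵤ; ∣m⇒∣m*n; ∣n⇒∣m*n; ∣m∣n⇒∣m-n)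
open import Data.Integer.Properties using (*-comm; *-zeroˡ; *-cancelˡ-≡; abs-*)
open import Data.Integer.Tactic.RingSolver using (solve-∀)
open import Data.Nat.Base as ℕ using (ℕ; zero; suc; _∸_)
import Data.Nat.Divisibility as ℕ∣
import Data.Nat.Properties as ℕₚ
open import Data.Nat.Primality using (Prime; euclidsLemma)
open import Data.Product.Base using (∃-syntax; _×_; _,_; proj₁; proj₂; swap)
open import Data.Sum.Base as Sum using (_⊎_; inj₁; inj₂; fromInj₂)
open import Relation.Binary.PropositionalEquality.Core using (_≡_; _≢_; refl; sym; trans; cong; cong₂; subst; subst₂)
open import Relation.Binary.PropositionalEquality.Properties using (module ≡-Reasoning)
open import Relation.Nullary.Negation.Core using (¬_; contradiction)

private
  variable
    a b e : ℕ
    t x y z : ℤ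
    s s′ : ℤ → ℤ

-- The exponent pattern: period, shift and reflection.

OneOrTwo : ℕ → Set
OneOrTwo e = e ≡ 1 ⊎ e ≡ 2

3∸-oneOrTwo : OneOrTwo e → OneOrTwo (3 ∸ e)
3∸-oneOrTwo (inj₁ refl) = inj₂ refl
3∸-oneOrTwo (inj₂ refl) = inj₁ refl

3∸-involutive : OneOrTwo e → 3 ∸ (3 ∸ e) ≡ e
3∸-involutive (inj₁ refl) = refl
3∸-involutive (inj₂ refl) = refl

exponent-oneOrTwo : OneOrTwo a → OneOrTwo b → ∀ n → OneOrTwo (exponent a b (+ n))
exponent-oneOrTwo p q 0 = q
exponent-oneOrTwo p q 1 = p
exponent-oneOrTwo p q 2 = 3∸-oneOrTwo q
exponent-oneOrTwo p q 3 = 3∸-oneOrTwo p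
exponent-oneOrTwo p q (suc (suc (suc (suc n)))) = exponent-oneOrTwo p q n

-- Reading (b, a, 3 - b, 3 - a) from its second entry gives the pattern of S_{3-b,a}; only the
-- wrap-around entry needs 3 - (3 - b) = b.
exponent-shift : OneOrTwo b → ∀ n → exponent a b (n + 1ℤ) ≡ exponent (3 ∸ b) a n
exponent-shift q (+ 0) = refl
exponent-shift q (+ 1) = refl
exponent-shift q (+ 2) = refl
exponent-shift q (+ 3) = sym (3∸-involutive q)
exponent-shift q (+ suc (suc (suc (suc n)))) = exponent-shift q (+ n)
exponent-shift q -[1+ 0 ] = sym (3∸-involutive q)
exponent-shift q -[1+ 1 ] = refl
exponent-shift q -[1+ 2 ] = refl
exponent-shift q -[1+ 3 ] = refl
-- Index -5 is separate so that each descent by 4 below lands where n + 1 is still negative.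
exponent-shift q -[1+ suc (suc (suc (suc zero))) ] = sym (3∸-involutive q)
exponent-shift q -[1+ suc (suc (suc (suc (suc n)))) ] = exponent-shift q -[1+ suc n ]

exponent-negative : ∀ a b n → exponent b a (+ (2 ℕ.+ n)) ≡ exponent a b -[1+ n ]
exponent-negative a b 0 = refl
exponent-negative a b 1 = refl
exponent-negative a b 2 = refl
exponent-negative a b 3 = refl
exponent-negative a b (suc (suc (suc (suc n)))) = exponent-negative a b n

-- Reflection about 1/2 exchanges positions 0 and 1, and positions 2 and 3, modulo 4; this amounts
-- to exchanging a and b.
exponent-reflect : ∀ a b n → exponent a b (1ℤ - n) ≡ exponent b a n
exponent-reflect a b (+ 0) = refl
exponent-reflect a b (+ 1) = refl
exponent-reflect a b (+ suc (suc n)) = sym (exponent-negative a b n)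
exponent-reflect a b -[1+ n ] = exponent-negative b a n

-- Arithmetic of the polynomials X³ + X^e + 1.

-- Identities about poly are stated with the powers unfolded as _^_ computes
-- them, so that the ring solver sees products and the types still match.
∣poly-1 : OneOrTwo e → ∀ x → x ∣ poly e x - 1ℤ
∣poly-1 (inj₁ refl) x = divides (x * x + 1ℤ) (identity x)
  where
  identity : ∀ x → x * (x * (x * 1ℤ)) + x * 1ℤ + 1ℤ - 1ℤ ≡ (x * x + 1ℤ) * x
  identity = solve-∀
∣poly-1 (inj₂ refl) x = divides (x * x + x) (identity x)
  where
  identity : ∀ x → x * (x * (x * 1ℤ)) + x * (x * 1ℤ) + 1ℤ - 1ℤ ≡ (x * x + x) * x
  identity = solve-∀

poly-at-unit≢0 : OneOrTwo e → ∀ x → ∣ x ∣ ≡ 1 → poly e x ≢ 0ℤ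
poly-at-unit≢0 (inj₁ refl) (+ 1) refl ()
poly-at-unit≢0 (inj₁ refl) -[1+ 0 ] refl ()
poly-at-unit≢0 (inj₂ refl) (+ 1) refl ()
poly-at-unit≢0 (inj₂ refl) -[1+ 0 ] refl ()

-- An integer root would divide the constant term 1, hence be ±1, where the values are 3, 1 or -1.
poly≢0 : OneOrTwo e → ∀ x → poly e x ≢ 0ℤ
poly≢0 p x eq = poly-at-unit≢0 p x (ℕ∣.∣1⇒≡1 (∣⇒∣ᵤ x∣-1)) eq
  where
  x∣-1 : x ∣ 0ℤ - 1ℤ
  x∣-1 = subst (λ k → x ∣ k - 1ℤ) eq (∣poly-1 p x)

*≡poly-cancelˡ : OneOrTwo e → ∀ x t → x * y ≡ poly e t → x * z ≡ poly e t → y ≡ z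
*≡poly-cancelˡ {y = y} {z} p x t xy xz =
  *-cancelˡ-≡ x y z {{≢-nonZero x≢0}} (trans xy (sym xz))
  where
  x≢0 : x ≢ 0ℤ
  x≢0 refl = poly≢0 p t (trans (sym xy) (*-zeroˡ y))

-- Multiplying `poly b x` by z³ gives (xz)³ + (xz)^b z^(3-b) + z³, which becomes `poly (3 ∸ b) z`
-- when xz is replaced by 1. The long cofactor is the difference of the two divided by xz - 1.
∣poly-reciprocal : OneOrTwo b → ∀ x z → y ∣ x * z - 1ℤ → y ∣ poly b x → y ∣ poly (3 ∸ b) z
∣poly-reciprocal {y = y} (inj₁ refl) x z y∣xz-1 y∣P =
  subst (y ∣_) (sym (identity x z))
    (∣m∣n⇒∣m-n (∣n⇒∣m*n (z ^ 3) y∣P)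
      (∣m⇒∣m*n (x * z * (x * z) + x * z + 1ℤ + z * z) y∣xz-1))
  where
  identity : ∀ x z →
    z * (z * (z * 1ℤ)) + z * (z * 1ℤ) + 1ℤ
      ≡ z * (z * (z * 1ℤ)) * (x * (x * (x * 1ℤ)) + x * 1ℤ + 1ℤ)
        - (x * z - 1ℤ) * (x * z * (x * z) + x * z + 1ℤ + z * z)
  identity = solve-∀
∣poly-reciprocal {y = y} (inj₂ refl) x z y∣xz-1 y∣P =
  subst (y ∣_) (sym (identity x z))
    (∣m∣n⇒∣m-n (∣n⇒∣m*n (z ^ 3) y∣P)
      (∣m⇒∣m*n (x * z * (x * z) + x * z + 1ℤ + (x * z + 1ℤ) * z) y∣xz-1))
  where
  identity : ∀ x z →
    z * (z * (z * 1ℤ)) + z * 1ℤ + 1ℤ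
      ≡ z * (z * (z * 1ℤ)) * (x * (x * (x * 1ℤ)) + x * (x * 1ℤ) + 1ℤ)
        - (x * z - 1ℤ) * (x * z * (x * z) + x * z + 1ℤ + (x * z + 1ℤ) * z)
  identity = solve-∀

-- Existence of chains.

satisfies-next : OneOrTwo a → OneOrTwo b → ∀ x y z →
  Consecutive a b x y z → Satisfies (3 ∸ b) a y z
satisfies-next p q x y z ((_ , y∣P) , xz≡P) =
  ∣poly-reciprocal q x z (subst (λ k → y ∣ k - 1ℤ) (sym xz≡P) (∣poly-1 p y)) y∣P ,
  divides x (sym xz≡P)

quotient-consecutive : ∀ a b x y (h : Satisfies a b x y) →
  Consecutive a b x y (quotient (proj₁ h))
quotient-consecutive a b x y h@(divides q eq , _) = h , trans (*-comm x q) (sym eq)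

-- Each step advances the starting pair along the chain and passes from S_{a,b} to S_{3-b,a}, so the
-- divisibility that yields the next term is always at hand.
ray : OneOrTwo a → OneOrTwo b → ∀ x y → Satisfies a b x y → ℕ → ℤ
ray p q x y h zero = x
ray {a} {b} p q x y h (suc n) = ray (3∸-oneOrTwo q) p y (quotient (proj₁ h))
  (satisfies-next p q x y _ (quotient-consecutive a b x y h)) n

ray-recurrence : (p : OneOrTwo a) (q : OneOrTwo b) (x y : ℤ) (h : Satisfies a b x y) → ∀ n →
  ray p q x y h n * ray p q x y h (2 ℕ.+ n)
    ≡ poly (exponent a b (+ suc n)) (ray p q x y h (suc n))
ray-recurrence {a} {b} p q x y h zero = proj₂ (quotient-consecutive a b x y h)
ray-recurrence {a} {b} p q x y h (suc n) =
  -- The tail is the ray of the advanced pair, so only its exponents need re-indexing.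
  trans (ray-recurrence (3∸-oneOrTwo q) p y _ _ n)
    (cong (λ e → poly e (ray p q x y h (2 ℕ.+ n))) exponents)
  where
  exponents : exponent (3 ∸ b) a (+ suc n) ≡ exponent a b (+ suc (suc n))
  exponents = trans (sym (exponent-shift q (+ suc n)))
    (cong (λ k → exponent a b (+ suc k)) (ℕₚ.+-comm n 1))

chain-exists : OneOrTwo a → OneOrTwo b → ∀ x y → Satisfies a b x y → ∃[ r ] IsChain a b x y r
chain-exists {a} {b} p q x y h = chain , record
  { satisfies  = h
  ; start₀     = refl
  ; start₁     = refl
  ; recurrence = recurrence
  }
  where
  back : ℕ → ℤ
  back = ray q p y x (swap h)

  chain : ℤ → ℤ
  chain (+ n)    = ray p q x y h n
  -- The reversed ray starts again with y and x, so index -1 reads its term 2.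
  chain -[1+ n ] = back (2 ℕ.+ n)

  chain-successor : ∀ n → chain (-[1+ n ] + 1ℤ) ≡ back (suc n)
  chain-successor zero    = refl
  chain-successor (suc n) = refl

  recurrence : ∀ n → chain (n - 1ℤ) * chain (n + 1ℤ) ≡ poly (exponent a b n) (chain n)
  -- Here the two rays meet: the neighbours of x are `back 2` and y.
  recurrence (+ zero) = trans (*-comm (back 2) y) (ray-recurrence q p y x (swap h) 0)
  recurrence (+ suc n) =
    subst (λ k → chain (+ n) * chain (+ suc k) ≡ poly (exponent a b (+ suc n)) (chain (+ suc n)))
      (ℕₚ.+-comm 1 n) (ray-recurrence p q x y h n)
  recurrence -[1+ n ] = begin
    chain -[1+ suc (n ℕ.+ 0) ] * chain (-[1+ n ] + 1ℤ)
      ≡⟨ cong₂ _*_ (cong (λ k → back (3 ℕ.+ k)) (ℕₚ.+-identityʳ n)) (chain-successor n) ⟩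
    back (3 ℕ.+ n) * back (suc n)
      ≡⟨ *-comm (back (3 ℕ.+ n)) (back (suc n)) ⟩
    back (suc n) * back (3 ℕ.+ n)
      ≡⟨ ray-recurrence q p y x (swap h) (suc n) ⟩
    poly (exponent b a (+ (2 ℕ.+ n))) (back (2 ℕ.+ n))
      ≡⟨ cong (λ e → poly e (back (2 ℕ.+ n))) (exponent-negative a b n) ⟩
    poly (exponent a b -[1+ n ]) (back (2 ℕ.+ n)) ∎
    where open ≡-Reasoning

-- Symmetries and uniqueness of chains.

-- Carries uniqueness from nonnegative to negative indices.
chain-reflect : IsChain a b x y s → IsChain b a y x (λ n → s (1ℤ - n))
chain-reflect {a} {b} {s = s} c = record
  { satisfies  = swap satisfies
  ; start₀     = start₁
  ; start₁     = start₀
  ; recurrence = λ n → begin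
      s (1ℤ - (n - 1ℤ)) * s (1ℤ - (n + 1ℤ))
        ≡⟨ cong₂ (λ i j → s i * s j) (right n) (left n) ⟩
      s (1ℤ - n + 1ℤ) * s (1ℤ - n - 1ℤ)
        ≡⟨ *-comm (s (1ℤ - n + 1ℤ)) (s (1ℤ - n - 1ℤ)) ⟩
      s (1ℤ - n - 1ℤ) * s (1ℤ - n + 1ℤ)
        ≡⟨ recurrence (1ℤ - n) ⟩
      poly (exponent a b (1ℤ - n)) (s (1ℤ - n))
        ≡⟨ cong (λ e → poly e (s (1ℤ - n))) (exponent-reflect a b n) ⟩
      poly (exponent b a n) (s (1ℤ - n)) ∎
  }
  where
  open IsChain c
  open ≡-Reasoning
  right : ∀ n → 1ℤ - (n - 1ℤ) ≡ 1ℤ - n + 1ℤ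
  right = solve-∀
  left : ∀ n → 1ℤ - (n + 1ℤ) ≡ 1ℤ - n - 1ℤ
  left = solve-∀

chain-shift : OneOrTwo a → OneOrTwo b → ∀ x y z → Consecutive a b x y z →
  IsChain a b x y s → IsChain (3 ∸ b) a y z (λ n → s (n + 1ℤ))
chain-shift {a} {b} {s = s} p q x y z h@(_ , xz≡P) c = record
  { satisfies  = satisfies-next p q x y z h
  ; start₀     = start₁
  -- Both `s (+ 2)` and z are the cofactor of x in `poly a y`, hence equal.
  ; start₁     = *≡poly-cancelˡ p x y
      (subst₂ (λ i j → i * s (+ 2) ≡ poly a j) start₀ start₁ (recurrence 1ℤ)) xz≡P
  ; recurrence = λ n →
      trans (cong (λ i → s i * s (n + 1ℤ + 1ℤ)) (reassociate n))
        (trans (recurrence (n + 1ℤ))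
          (cong (λ e → poly e (s (n + 1ℤ))) (exponent-shift q n)))
  }
  where
  open IsChain c
  reassociate : ∀ n → n - 1ℤ + 1ℤ ≡ n + 1ℤ - 1ℤ
  reassociate = solve-∀

-- The recurrence has order two, so the induction carries two neighbouring terms.
chain-unique⁺ : OneOrTwo a → OneOrTwo b → IsChain a b x y s → IsChain a b x y s′ →
  ∀ n → s (+ n) ≡ s′ (+ n) × s (+ suc n) ≡ s′ (+ suc n)
chain-unique⁺ p q c c′ zero =
  trans C.start₀ (sym C′.start₀) , trans C.start₁ (sym C′.start₁)
  where
  module C  = IsChain c
  module C′ = IsChain c′
chain-unique⁺ {a} {b} {s = s} {s′ = s′} p q c c′ (suc n)
  with eq₀ , eq₁ ← chain-unique⁺ p q c c′ n =
  eq₁ , *≡poly-cancelˡ (exponent-oneOrTwo p q (suc n)) (s (+ n)) (s (+ suc n)) (next c)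
    (subst₂ (λ i j → i * s′ (+ suc (suc n)) ≡ poly (exponent a b (+ suc n)) j)
      (sym eq₀) (sym eq₁) (next c′))
  where
  next : ∀ {r} → IsChain a b x y r →
    r (+ n) * r (+ suc (suc n)) ≡ poly (exponent a b (+ suc n)) (r (+ suc n))
  next {r = r} c =
    subst (λ k → r (+ n) * r (+ suc k) ≡ poly (exponent a b (+ suc n)) (r (+ suc n)))
      (ℕₚ.+-comm n 1) (IsChain.recurrence c (+ suc n))

chain-unique : OneOrTwo a → OneOrTwo b → IsChain a b x y s → IsChain a b x y s′ →
  ∀ n → s n ≡ s′ n
chain-unique p q c c′ (+ n)    = proj₁ (chain-unique⁺ p q c c′ n)
chain-unique p q c c′ -[1+ n ] =
  proj₁ (chain-unique⁺ q p (chain-reflect c) (chain-reflect c′) (2 ℕ.+ n))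

consecutive⇒sameChain : OneOrTwo a → OneOrTwo b → ∀ x y z → Consecutive a b x y z →
  SameChain a b x y (3 ∸ b) a y z
consecutive⇒sameChain p q x y z h =
  chain-exists p q x y (proj₁ h) ,
  chain-exists (3∸-oneOrTwo q) p y z (satisfies-next p q x y z h) ,
  λ s s′ c c′ → 1ℤ , inj₁ (chain-unique (3∸-oneOrTwo q) p c′ (chain-shift p q x y z h c))

-- The third root modulo a prime.

prime∣*⇒∣⊎∣ : Prime ∣ t ∣ → t ∣ x * y → (t ∣ x) ⊎ (t ∣ y)
prime∣*⇒∣⊎∣ {t} {x} {y} pr t∣xy =
  Sum.map ∣ᵤ⇒∣ ∣ᵤ⇒∣ (euclidsLemma ∣ x ∣ ∣ y ∣ pr (subst (∣ t ∣ ℕ∣.∣_) (abs-* x y) (∣⇒∣ᵤ t∣xy)))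

third-root : ∀ u v w → Prime ∣ t ∣ → ¬ t ∣ u - v → t ∣ poly 1 u → t ∣ poly 1 v →
  t ∣ u * (v * w) - 1ℤ → t ∣ poly 1 (- w)
third-root {t} u v w pr t∤u-v t∣u t∣v t∣uvw-1 =
  subst (t ∣_) (sym (root u v w))
    (∣m∣n⇒∣m-n t∣poly-sum (∣m⇒∣m*n (w * w + w * (u + v) + (u + v) * (u + v) + 1ℤ) t∣d))
  where
  -- This is (P(u) - P(v)) / (u - v) for P = X³ + X + 1. The prime t divides P(u) - P(v) but not u -
  -- v, so it divides `q`.
  q : ℤ
  q = u * u + u * v + v * v + 1ℤ

  difference : ∀ u v →
    (u * (u * (u * 1ℤ)) + u * 1ℤ + 1ℤ) - (v * (v * (v * 1ℤ)) + v * 1ℤ + 1ℤ)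
      ≡ (u - v) * (u * u + u * v + v * v + 1ℤ)
  difference = solve-∀

  t∣q : t ∣ q
  t∣q = fromInj₂ (λ t∣u-v → contradiction t∣u-v t∤u-v)
    (prime∣*⇒∣⊎∣ pr (subst (t ∣_) (difference u v) (∣m∣n⇒∣m-n t∣u t∣v)))

  -- Since u q - P(u) = uv(u + v) - 1, the right side is (u + v)(uvw - 1) - w(uv(u + v) - 1), and
  -- both products vanish modulo t.
  vieta : ∀ u v w →
    w - (u + v) ≡ (u + v) * (u * (v * w) - 1ℤ)
      - w * (u * (u * u + u * v + v * v + 1ℤ) - (u * (u * (u * 1ℤ)) + u * 1ℤ + 1ℤ))
  vieta = solve-∀

  t∣d : t ∣ w - (u + v)
  t∣d = subst (t ∣_) (sym (vieta u v w))
    (∣m∣n⇒∣m-n (∣n⇒∣m*n (u + v) t∣uvw-1) (∣n⇒∣m*n w (∣m∣n⇒∣m-n (∣n⇒∣m*n u t∣q) t∣u)))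

  t∣poly-sum : t ∣ poly 1 u - (u + u + v) * q
  t∣poly-sum = ∣m∣n⇒∣m-n t∣u (∣n⇒∣m*n (u + u + v) t∣q)

  -- P(u) - (2u + v) q equals P(-(u + v)), and the last product is P(-(u + v)) - P(-w) with w - (u +
  -- v) factored out.
  root : ∀ u v w →
    (- w) * ((- w) * ((- w) * 1ℤ)) + (- w) * 1ℤ + 1ℤ
      ≡ (u * (u * (u * 1ℤ)) + u * 1ℤ + 1ℤ) - (u + u + v) * (u * u + u * v + v * v + 1ℤ)
        - (w - (u + v)) * (w * w + w * (u + v) + (u + v) * (u + v) + 1ℤ)
  root = solve-∀

theorem12 : (l : ℕ) → l ≡ 1 ⊎ l ≡ 2 →
    (u t v w : ℤ) →
    Consecutive l 1 u t (v * w) →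
    Satisfies l 1 v t →
    Prime ∣ t ∣ →
    ¬ (t ∣ (u - v)) →
    Satisfies l 1 (- w) t
      × Consecutive l 1 (- w) t (- (u * v))
      × SameChain l 1 (- w) t 2 l t (- (u * v))
theorem12 l p u t v w ((_ , t∣u) , uvw≡P) (_ , t∣v) pr t∤u-v =
  -- With second exponent 1, advancing by one term leads to S_{2,l}.
  proj₁ consecutive , consecutive , consecutive⇒sameChain p (inj₁ refl) _ _ _ consecutive
  where
  regroup : ∀ u v w → (- w) * (- (u * v)) ≡ u * (v * w)
  regroup = solve-∀

  product : (- w) * (- (u * v)) ≡ poly l t
  product = trans (regroup u v w) uvw≡P

  consecutive : Consecutive l 1 (- w) t (- (u * v))
  consecutive =
    ( divides (- (u * v)) (trans (sym product) (*-comm (- w) (- (u * v))))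
    , third-root u v w pr t∤u-v t∣u t∣v (subst (λ k → t ∣ k - 1ℤ) (sym uvw≡P) (∣poly-1 p t))
    ) , product
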